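{- For all rational numbers $n_1,n_2$, define $$\begin{aligned} x_1&=-4n_1(n_1-n_2)(n_1+n_2)(n_1^2-3n_1n_2+n_2^2),\\ x_2&=-4n_1(n_1^4-4n_1^3n_2+5n_1^2n_2^2-n_2^4),\\ x_3&=4(n_1^2-n_1n_2+n_2^2)(n_1^3-3n_1^2n_2+n_2^3),\\ x_4&=-4n_2(n_1^4-4n_1^3n_2+n_1^2n_2^2+2n_1n_2^3-n_2^4),\\ x_5&=-4n_1n_2(n_1-2n_2)(n_1^2+n_1n_2-n_2^2),\\ x_6&=4(n_1-n_2)(n_1^4-2n_1^3n_2-n_1^2n_2^2+n_2^4),\\ x_7&=4n_2(2n_1-n_2)(n_1-n_2)(n_1^2-n_1n_2-n_2^2), \end{aligned}$$ and $y_i=-x_i$ for $i=1,\dots,7$. Then $$\sum_{i=1}^7x_i^r=\sum_{i=1}^7y_i^r\qquad\text{for } r=1,2,3,4,5,6.$$ Moreover, as a parametric solution this is nontrivial: in $\mathbb{Q}[n_1,n_2]$ the multisets $\{x_1,\dots,x_7\}$ and $\{y_1,\dots,y_7\}$ are distinct.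
   Context: An ideal solution of the Tarry-Escott problem of degree $k$ consists of two distinct multisets $\{x_1,\dots,x_{k+1}\}$, $\{y_1,\dots,y_{k+1}\}$ with $\sum x_i^r=\sum y_i^r$ for $r=1,\dots,k$. -}

module Defs where

open import Algebra.Bundles.Raw using (RawRing)
import Algebra.Definitions.RawSemiring as RawSemiringOps
open import Data.List.Base using (List)
open import Data.Nat.Base using (ℕ; zero; suc)
open import Data.Rational.Base using (ℚ; +-*-rawRing)
open import Data.Vec.Functional using (Vector; toList)
open import Level using (0ℓ)
open import Relation.Binary.Bundles using (Setoid)
open import Relation.Binary.PropositionalEquality.Core using (refl; sym; trans)

-- Univariate polynomials over R as coefficient lists, constant term first.
-- Trailing zeros are allowed, so a polynomial has many representatives;
-- equality is equality of all coefficients.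
module Polynomials {c ℓ} (R : RawRing c ℓ) where

  open import Data.List.Base using ([]; _∷_; map)
  private module R = RawRing R

  Poly : Set c
  Poly = List R.Carrier

  coeff : Poly → ℕ → R.Carrier
  coeff []      _       = R.0#
  coeff (a ∷ _) zero    = a
  coeff (_ ∷ p) (suc k) = coeff p k

  infix 4 _≈ₚ_
  _≈ₚ_ : Poly → Poly → Set ℓ
  p ≈ₚ q = ∀ k → coeff p k R.≈ coeff q k

  infixl 6 _+ₚ_
  _+ₚ_ : Poly → Poly → Poly
  []      +ₚ q       = q
  (a ∷ p) +ₚ []      = a ∷ p
  (a ∷ p) +ₚ (b ∷ q) = (a R.+ b) ∷ (p +ₚ q)

  -- (a + X p) q = a q + X (p q)
  infixl 7 _*ₚ_
  _*ₚ_ : Poly → Poly → Poly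
  []      *ₚ q = []
  (a ∷ p) *ₚ q = map (a R.*_) q +ₚ (R.0# ∷ (p *ₚ q))

  const : R.Carrier → Poly
  const a = a ∷ []

  X : Poly
  X = R.0# ∷ R.1# ∷ []

  rawRing : RawRing c ℓ
  rawRing = record
    { Carrier = Poly
    ; _≈_     = _≈ₚ_
    ; _+_     = _+ₚ_
    ; _*_     = _*ₚ_
    ; -_      = map R.-_
    ; 0#      = []
    ; 1#      = const R.1#
    }

-- ℚ[n₁,n₂] as ℚ[n₁][n₂].
ℚ[n₁] : RawRing 0ℓ 0ℓ
ℚ[n₁] = Polynomials.rawRing +-*-rawRing

ℚ[n₁,n₂] : RawRing 0ℓ 0ℓ
ℚ[n₁,n₂] = Polynomials.rawRing ℚ[n₁]

ℚ[n₁,n₂]-setoid : Setoid 0ℓ 0ℓ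
ℚ[n₁,n₂]-setoid = record
  { Carrier       = RawRing.Carrier ℚ[n₁,n₂]
  ; _≈_           = RawRing._≈_ ℚ[n₁,n₂]
  ; isEquivalence = record
    { refl  = λ _ _ → refl
    ; sym   = λ p≈q j i → sym (p≈q j i)
    ; trans = λ p≈q q≈r j i → trans (p≈q j i) (q≈r j i)
    }
  }

𝐧₁ 𝐧₂ : RawRing.Carrier ℚ[n₁,n₂]
𝐧₁ = Polynomials.const ℚ[n₁] (Polynomials.X +-*-rawRing)
𝐧₂ = Polynomials.X ℚ[n₁]

-- The formulas for xᵢ and yᵢ, stated over an arbitrary ring so that the same
-- text serves for rational numbers and for polynomials.
-- Here k × a is the k-fold sum a + ⋯ + a, and k × a ^ m reads k × (a ^ m).
module Parametrization {c ℓ} (R : RawRing c ℓ) where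

  open import Data.Vec.Functional using ([]; _∷_)
  open RawRing R
  open RawSemiringOps rawSemiring using (_×_; _^_)

  private
    infixl 6 _-_
    _-_ : Carrier → Carrier → Carrier
    a - b = a + (- b)

  x : Carrier → Carrier → Vector Carrier 7
  x n₁ n₂ =
      - (4 × n₁) * (n₁ - n₂) * (n₁ + n₂) * (n₁ ^ 2 - 3 × n₁ * n₂ + n₂ ^ 2)
    ∷ - (4 × n₁) * (n₁ ^ 4 - 4 × n₁ ^ 3 * n₂ + 5 × n₁ ^ 2 * n₂ ^ 2 - n₂ ^ 4)
    ∷ 4 × (n₁ ^ 2 - n₁ * n₂ + n₂ ^ 2) * (n₁ ^ 3 - 3 × n₁ ^ 2 * n₂ + n₂ ^ 3)
    ∷ - (4 × n₂) * (n₁ ^ 4 - 4 × n₁ ^ 3 * n₂ + n₁ ^ 2 * n₂ ^ 2 + 2 × n₁ * n₂ ^ 3 - n₂ ^ 4)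
    ∷ - (4 × n₁) * n₂ * (n₁ - 2 × n₂) * (n₁ ^ 2 + n₁ * n₂ - n₂ ^ 2)
    ∷ 4 × (n₁ - n₂) * (n₁ ^ 4 - 2 × n₁ ^ 3 * n₂ - n₁ ^ 2 * n₂ ^ 2 + n₂ ^ 4)
    ∷ 4 × n₂ * (2 × n₁ - n₂) * (n₁ - n₂) * (n₁ ^ 2 - n₁ * n₂ - n₂ ^ 2)
    ∷ []

  y : Carrier → Carrier → Vector Carrier 7
  y n₁ n₂ i = - x n₁ n₂ i

module Rational where
  open Parametrization +-*-rawRing public using (x; y)
  open RawSemiringOps (RawRing.rawSemiring +-*-rawRing) public using (sum; _^_)

-- Multisets are lists up to permutation and equality in ℚ[n₁,n₂].
module Parametric where
  open Parametrization ℚ[n₁,n₂]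
  open import Data.List.Relation.Binary.Permutation.Setoid ℚ[n₁,n₂]-setoid public
    using (_↭_)

  xs ys : List (RawRing.Carrier ℚ[n₁,n₂])
  xs = toList (x 𝐧₁ 𝐧₂)
  ys = toList (y 𝐧₁ 𝐧₂)

{-# OPTIONS --safe #-}

-- Since yᵢ = -xᵢ, the even power sums agree termwise, and the odd ones agree as
-- soon as ∑ xᵢ = ∑ xᵢ³ = ∑ xᵢ⁵ = 0, which are identities in ℤ[n₁,n₂].
-- For nontriviality, x₇ has n₁⁴n₂-coefficient 8, whereas the n₁⁴n₂-coefficients
-- of the yᵢ are -12, -16, 16, 4, 4, 12 and -8.
module Submission where

open import Defs
open import Algebra.Bundles.Raw using (RawRing)
import Algebra.Definitions.RawSemiring as RawSemiringOps
import Algebra.Properties.Monoid.Sum as MonoidSum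
open import Data.Fin.Base using (zero; suc)
open import Data.Integer.Base using (+_)
open import Data.List.Relation.Binary.Permutation.Setoid.Properties ℚ[n₁,n₂]-setoid
  using (Any-resp-↭)
open import Data.List.Relation.Unary.Any using (any?)
open import Data.Nat.Base using (ℕ; zero; suc; _≤_; s≤s)
open import Data.Product.Base using (_×_; _,_)
open import Data.Rational.Base using (ℚ; 0ℚ; 1ℚ; _+_; -_; _/_; +-*-rawRing)
open import Data.Rational.Properties using (_≟_; neg-distrib-+; +-0-monoid)
open import Data.Rational.Solver using (module +-*-Solver)
open import Data.Vec.Base using ([]; _∷_)
open import Data.Vec.Functional using (Vector)
open import Function.Base using (_∘_)
open import Level using (0ℓ)
open import Relation.Binary.Definitions using (_Respects_)
open import Relation.Binary.PropositionalEquality.Core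
  using (_≡_; refl; sym; trans; cong)
open import Relation.Nullary.Decidable.Core using (from-yes; from-no)
open import Relation.Nullary.Negation.Core using (¬_)
open import Relation.Unary using (Decidable)
open +-*-Solver using (Polynomial; con; var; _:+_; _:*_; :-_; _:^_; _:=_; prove; solve)
open MonoidSum +-0-monoid using (sum-cong-≗)
open Rational using (x; y; sum; _^_)
open Parametric using (xs; ys; _↭_)

-- Instantiating the formulas for xᵢ at the ring solver's expressions yields
-- their reflected form, so they need not be transcribed.
expressions : RawRing 0ℓ 0ℓ
expressions = record
  { Carrier = Polynomial 2
  ; _≈_     = _≡_
  ; _+_     = _:+_
  ; _*_     = _:*_
  ; -_      = :-_
  ; 0#      = con 0ℚ
  ; 1#      = con 1ℚ
  }

-- Evaluating this expression at `n₁`, `n₂` unfolds definitionally to `sum (λ i → x n₁ n₂ i ^ r)`,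
-- so `prove` applies at that type.
powerSumExpr : ℕ → Polynomial 2
powerSumExpr r = Ops.sum (λ i → Expr.x (var zero) (var (suc zero)) i Ops.^ r)
  where
  module Expr = Parametrization expressions
  module Ops  = RawSemiringOps (RawRing.rawSemiring expressions)

∑x≡0 : ∀ n₁ n₂ → sum (λ i → x n₁ n₂ i ^ 1) ≡ 0ℚ
-- All coefficients cancel during normalisation, leaving the normal form of `con 0ℚ`; hence `refl`.
∑x≡0 n₁ n₂ = prove (n₁ ∷ n₂ ∷ []) (powerSumExpr 1) (con 0ℚ) refl

∑x³≡0 : ∀ n₁ n₂ → sum (λ i → x n₁ n₂ i ^ 3) ≡ 0ℚ
∑x³≡0 n₁ n₂ = prove (n₁ ∷ n₂ ∷ []) (powerSumExpr 3) (con 0ℚ) refl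

∑x⁵≡0 : ∀ n₁ n₂ → sum (λ i → x n₁ n₂ i ^ 5) ≡ 0ℚ
∑x⁵≡0 n₁ n₂ = prove (n₁ ∷ n₂ ∷ []) (powerSumExpr 5) (con 0ℚ) refl

sum-neg : ∀ {n} (u : Vector ℚ n) → sum (λ i → - u i) ≡ - sum u
sum-neg {zero}  u = refl
sum-neg {suc n} u = trans (cong (_+_ (- u zero)) (sum-neg (u ∘ suc)))
                          (sym (neg-distrib-+ (u zero) (sum (u ∘ suc))))

-- Parity enters as a hypothesis on `r`, an identity in one variable that the ring solver settles
-- for each literal exponent.
even-power-sum : ∀ r → (∀ a → (- a) ^ r ≡ a ^ r) → ∀ {n} (u : Vector ℚ n) →
  sum (λ i → u i ^ r) ≡ sum (λ i → (- u i) ^ r)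
even-power-sum r even u = sum-cong-≗ (λ i → sym (even (u i)))

odd-power-sum : ∀ r → (∀ a → (- a) ^ r ≡ - (a ^ r)) → ∀ {n} (u : Vector ℚ n) →
  sum (λ i → u i ^ r) ≡ 0ℚ → sum (λ i → u i ^ r) ≡ sum (λ i → (- u i) ^ r)
-- Both sides vanish: the right one is the negated left one, and `- 0ℚ` computes to `0ℚ`.
odd-power-sum r odd u ∑≡0 = trans ∑≡0 (sym (trans (sum-cong-≗ (odd ∘ u))
  (trans (sum-neg (λ i → u i ^ r)) (cong -_ ∑≡0))))

power-sums-agree : ∀ n₁ n₂ r → 1 ≤ r → r ≤ 6 →
  sum (λ i → x n₁ n₂ i ^ r) ≡ sum (λ i → y n₁ n₂ i ^ r)
power-sums-agree n₁ n₂ 1 _ _ =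
  odd-power-sum 1 (solve 1 (λ a → (:- a) :^ 1 := :- (a :^ 1)) refl) (x n₁ n₂) (∑x≡0 n₁ n₂)
power-sums-agree n₁ n₂ 2 _ _ =
  even-power-sum 2 (solve 1 (λ a → (:- a) :^ 2 := a :^ 2) refl) (x n₁ n₂)
power-sums-agree n₁ n₂ 3 _ _ =
  odd-power-sum 3 (solve 1 (λ a → (:- a) :^ 3 := :- (a :^ 3)) refl) (x n₁ n₂) (∑x³≡0 n₁ n₂)
power-sums-agree n₁ n₂ 4 _ _ =
  even-power-sum 4 (solve 1 (λ a → (:- a) :^ 4 := a :^ 4) refl) (x n₁ n₂)
power-sums-agree n₁ n₂ 5 _ _ =
  odd-power-sum 5 (solve 1 (λ a → (:- a) :^ 5 := :- (a :^ 5)) refl) (x n₁ n₂) (∑x⁵≡0 n₁ n₂)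
power-sums-agree n₁ n₂ 6 _ _ =
  even-power-sum 6 (solve 1 (λ a → (:- a) :^ 6 := a :^ 6) refl) (x n₁ n₂)
-- For `r ≥ 7`, peeling six successors off `r ≤ 6` leaves the empty `suc _ ≤ 0`; `r = 0` is excluded
-- by `1 ≤ 0`.
power-sums-agree n₁ n₂ (suc (suc (suc (suc (suc (suc (suc _))))))) _
  (s≤s (s≤s (s≤s (s≤s (s≤s (s≤s ()))))))

-- In `ℚ[n₁][n₂]` the outer index 1 is the exponent of `n₂` and the inner index 4 that of `n₁`.
[n₁⁴n₂] : RawRing.Carrier ℚ[n₁,n₂] → ℚ
[n₁⁴n₂] p = Polynomials.coeff +-*-rawRing (Polynomials.coeff ℚ[n₁] p 1) 4

Has8n₁⁴n₂ : RawRing.Carrier ℚ[n₁,n₂] → Set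
Has8n₁⁴n₂ p = [n₁⁴n₂] p ≡ + 8 / 1

has8n₁⁴n₂? : Decidable Has8n₁⁴n₂
has8n₁⁴n₂? p = [n₁⁴n₂] p ≟ + 8 / 1

Has8n₁⁴n₂-resp-≈ : Has8n₁⁴n₂ Respects (RawRing._≈_ ℚ[n₁,n₂])
Has8n₁⁴n₂-resp-≈ p≈q p-has = trans (sym (p≈q 1 4)) p-has

xs-not-↭-ys : ¬ (xs ↭ ys)
-- A permutation would carry the coefficient 8 of `x₇` over to some entry of `ys`; computing the
-- seven coefficients there refutes this.
xs-not-↭-ys xs↭ys = from-no (any? has8n₁⁴n₂? ys)
  (Any-resp-↭ {P = Has8n₁⁴n₂} (λ {p} {q} → Has8n₁⁴n₂-resp-≈ {p} {q}) xs↭ys (from-yes (any? has8n₁⁴n₂? xs)))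

mainTheorem6 : (∀ (n₁ n₂ : ℚ) (r : ℕ) → 1 ≤ r → r ≤ 6 →
    sum (λ i → x n₁ n₂ i ^ r) ≡ sum (λ i → y n₁ n₂ i ^ r))
    × ¬ (xs ↭ ys)
mainTheorem6 = power-sums-agree , xs-not-↭-ys
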